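{- Let $G$ be a graph (loops allowed) with finite vertex set $V$, and let $\varphi$ be a finite sequence of local complementation, edge complementation and loop complementation operations applicable to $G$. Then $G\varphi = G+X*Y+Z$ for some $X,Y,Z\subseteq V$ with $X\subseteq Y$ (in particular, $*Y$ is applicable to $G+X$).
   Context: Graphs are finite, undirected, without parallel edges, loops allowed; a graph $G$ with vertex set $V$ is identified with its adjacency matrix, a symmetric $V\times V$-matrix over $\mathbb{F}_2$ whose diagonal entry at $u$ is $1$ iff $u$ has a loop. $G[X]$ is the induced subgraph (principal submatrix) on $X$, with $\det G[\varnothing]=1$. Operations are written postfix and associate to the left. Loop complementation $G+X$ ($X\subseteq V$): add $1$ to each diagonal entry indexed by an element of $X$; it is always applicable. Pivot $G*X$ is defined (applicable) iff $\det G[X]=1$ over $\mathbb{F}_2$. In that case, writing $G=\begin{pmatrix} P & Q \\ R & S \end{pmatrix}$ with $P=G[X]$, $$G*X=\begin{pmatrix} P^{ -1} & P^{ -1} Q \\ R P^{ -1} & S + R P^{ -1} Q \end{pmatrix},$$ again a symmetric matrix over $\mathbb{F}_2$. Local complementation is the pivot $G*\{u\}$ where $u$ is a vertex with a loop. Edge complementation is the pivot $G*\{u,v\}$ where $\{u,v\}$ is an edge between distinct vertices $u,v$ both without a loop. A sequence of operations is applicable to $G$ if each operation is applicable to the graph resulting from the previous ones. -}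

module Defs where

open import Algebra.Bundles using (CommutativeRing)
open import Data.Bool using (Bool; true; false; _∧_; _xor_)
open import Data.Bool.Properties using (xor-∧-commutativeRing)
open import Data.Fin using (Fin; zero; suc)
open import Data.Fin.Properties using (_≟_)
open import Data.Fin.Subset using (Subset; inside; outside; ∣_∣; ∁; ⁅_⁆; _∪_)
open import Data.List using (List; []; _∷_)
open import Data.Nat using (ℕ; zero; suc)
open import Data.Vec using (_∷_; lookup)
open import Data.Vec.Functional using (removeAt)
open import Relation.Binary.PropositionalEquality
  using (_≡_; _≢_; refl; sym; cong; cong₂)
open import Relation.Nullary using (yes; no; does; contradiction)

-- The field 𝔽₂ is Bool, with addition _xor_ and multiplication _∧_.

private
  module 𝔽₂ = CommutativeRing xor-∧-commutativeRing

open import Algebra.Properties.CommutativeMonoid.Sum 𝔽₂.+-commutativeMonoid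
  using (sum) public

Matrix : ℕ → ℕ → Set
Matrix m n = Fin m → Fin n → Bool

infix  4 _≈ᴹ_
infixl 6 _+ᴹ_
infixl 7 _·ᴹ_

_≈ᴹ_ : ∀ {m n} → Matrix m n → Matrix m n → Set
A ≈ᴹ B = ∀ i j → A i j ≡ B i j

_+ᴹ_ : ∀ {m n} → Matrix m n → Matrix m n → Matrix m n
(A +ᴹ B) i j = A i j xor B i j

_·ᴹ_ : ∀ {l m n} → Matrix l m → Matrix m n → Matrix l n
(A ·ᴹ B) i k = sum (λ j → A i j ∧ B j k)

1ᴹ : ∀ {n} → Matrix n n
1ᴹ i j = does (i ≟ j)

-- Laplace expansion along the first row; the signs (-1)ʲ are all 1 in 𝔽₂.
det : ∀ {n} → Matrix n n → Bool
det {zero}  A = true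
det {suc n} A = sum (λ j → A zero j ∧ det (λ i → removeAt (A (suc i)) j))

record IsInverse {n} (A B : Matrix n n) : Set where
  field
    inverseˡ : B ·ᴹ A ≈ᴹ 1ᴹ
    inverseʳ : A ·ᴹ B ≈ᴹ 1ᴹ

-- The increasing enumeration of the elements of a subset.
element : ∀ {n} (X : Subset n) → Fin ∣ X ∣ → Fin n
element (inside  ∷ X) zero    = zero
element (inside  ∷ X) (suc i) = suc (element X i)
element (outside ∷ X) i       = suc (element X i)

infix 8 _[_,_]

_[_,_] : ∀ {n} → Matrix n n → (X Y : Subset n) → Matrix ∣ X ∣ ∣ Y ∣
(A [ X , Y ]) i j = A (element X i) (element Y j)

-- A graph on the vertex set Fin n; loops are the diagonal entries.
record Graph (n : ℕ) : Set where
  field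
    adj       : Matrix n n
    symmetric : ∀ u v → adj u v ≡ adj v u

open Graph public

infix 4 _≈_

_≈_ : ∀ {n} → Graph n → Graph n → Set
G ≈ H = adj G ≈ᴹ adj H

diagonal : ∀ {n} → Subset n → Matrix n n
diagonal X u v = does (u ≟ v) ∧ lookup X u

diagonal-symmetric : ∀ {n} (X : Subset n) u v → diagonal X u v ≡ diagonal X v u
diagonal-symmetric X u v with u ≟ v | v ≟ u
... | yes u≡v | yes _   = cong (lookup X) u≡v
... | yes u≡v | no v≢u  = contradiction (sym u≡v) v≢u
... | no u≢v  | yes v≡u = contradiction (sym v≡u) u≢v
... | no _    | no _    = refl

infixl 6 _+ᴸ_

_+ᴸ_ : ∀ {n} → Graph n → Subset n → Graph n
G +ᴸ X = record
  { adj       = adj G +ᴹ diagonal X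
  ; symmetric = λ u v → cong₂ _xor_ (symmetric G u v) (diagonal-symmetric X u v)
  }

-- "G * X is applicable and equals H".  Since inverses are unique, H is
-- determined by G and X up to _≈_.
record IsPivot {n} (G : Graph n) (X : Subset n) (H : Graph n) : Set where
  P : Matrix ∣ X ∣ ∣ X ∣
  P = adj G [ X , X ]

  Q : Matrix ∣ X ∣ ∣ ∁ X ∣
  Q = adj G [ X , ∁ X ]

  R : Matrix ∣ ∁ X ∣ ∣ X ∣
  R = adj G [ ∁ X , X ]

  S : Matrix ∣ ∁ X ∣ ∣ ∁ X ∣
  S = adj G [ ∁ X , ∁ X ]

  field
    applicable   : det P ≡ true
    P⁻¹          : Matrix ∣ X ∣ ∣ X ∣
    P⁻¹-inverse  : IsInverse P P⁻¹
    upper-left   : adj H [ X   , X   ] ≈ᴹ P⁻¹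
    upper-right  : adj H [ X   , ∁ X ] ≈ᴹ P⁻¹ ·ᴹ Q
    lower-left   : adj H [ ∁ X , X   ] ≈ᴹ R ·ᴹ P⁻¹
    lower-right  : adj H [ ∁ X , ∁ X ] ≈ᴹ S +ᴹ R ·ᴹ P⁻¹ ·ᴹ Q

data Operation (n : ℕ) : Set where
  localComplement : (u : Fin n) → Operation n
  edgeComplement  : (u v : Fin n) → Operation n
  loopComplement  : (X : Subset n) → Operation n

infix 4 _⟨_⟩⇒_ _⟨_⟩⇒*_

-- G ⟨ o ⟩⇒ H : the operation o is applicable to G, with result H.
data _⟨_⟩⇒_ {n} (G : Graph n) : Operation n → Graph n → Set where
  local : ∀ {u H} →
          adj G u u ≡ true →
          IsPivot G ⁅ u ⁆ H →
          G ⟨ localComplement u ⟩⇒ H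
  edge  : ∀ {u v H} →
          u ≢ v →
          adj G u v ≡ true →
          adj G u u ≡ false →
          adj G v v ≡ false →
          IsPivot G (⁅ u ⁆ ∪ ⁅ v ⁆) H →
          G ⟨ edgeComplement u v ⟩⇒ H
  loop  : ∀ {X H} →
          H ≈ G +ᴸ X →
          G ⟨ loopComplement X ⟩⇒ H

-- G ⟨ φ ⟩⇒* H : the sequence φ, applied from its head on, is applicable to G,
-- with result H.
data _⟨_⟩⇒*_ {n} (G : Graph n) : List (Operation n) → Graph n → Set where
  []  : ∀ {H} → H ≈ G → G ⟨ [] ⟩⇒* H
  _∷_ : ∀ {o φ K H} → G ⟨ o ⟩⇒ K → K ⟨ φ ⟩⇒* H → G ⟨ o ∷ φ ⟩⇒* H

{-# OPTIONS --safe #-}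
module Submission where

-- A graph G is identified with the subspace L(G) = { (x , y) | y = G x } of
-- (𝔽₂ × 𝔽₂)ⱽ.  Loop complementation on X adds x to y at the vertices in X, and
-- the pivot on X swaps x and y at the vertices in X.  Hence φ acts on L(G)
-- through an element of GL₂(𝔽₂) at each vertex, and each of the six elements of
-- GL₂(𝔽₂) is addᶻ ∘ swapʸ ∘ addˣ with x ≤ y.  This gives X, Y, Z, and for
-- H = Gφ + Z the principal submatrix H[Y] inverts (G + X)[Y].  That an invertible
-- matrix has determinant 1 is shown by column elimination along the first row.

open import Defs
open import Algebra.Bundles using (CommutativeRing)
open import Data.Bool using (Bool; true; false; not; _∧_; _xor_; if_then_else_)
open import Data.Bool.Properties
  using (∧-assoc; ∧-comm; ∧-identityʳ; ∧-zeroʳ; xor-assoc; xor-comm; xor-identityʳ; xor-same;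
         ∧-distribˡ-xor; ∧-distribʳ-xor; xor-∧-commutativeRing)
open import Data.Fin using (Fin; zero; suc)
open import Data.Fin.Subset using (Subset; inside; outside; ∣_∣; ∁; _⊆_)
open import Data.List using (List)
open import Data.Nat using (ℕ; zero; suc)
open import Data.Product using (∃-syntax; _×_; _,_; proj₁; proj₂; swap)
open import Data.Sum using (_⊎_; inj₁; inj₂)
open import Data.Unit using (⊤; tt)
open import Data.Vec
  using (Vec; []; _∷_; head; tail; map; tabulate; lookup; zipWith; replicate)
open import Data.Vec.Functional using (removeAt)
open import Data.Vec.Properties
  using (tabulate-∘; lookup∘tabulate; []=⇒lookup; lookup⇒[]=)
open import Data.Vec.Relation.Unary.All using (All; []; _∷_)
open import Data.Vec.Relation.Unary.All.Properties using () renaming (tabulate⁻ to All-tabulate⁻)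
open import Function using (_∘_)
open import Relation.Binary.PropositionalEquality
  using (_≡_; _≗_; refl; sym; trans; cong; cong₂; module ≡-Reasoning)
open import Algebra.Properties.CommutativeSemigroup
  (CommutativeRing.+-commutativeSemigroup xor-∧-commutativeRing)
  using () renaming (interchange to xor-interchange)
open import Algebra.Properties.Semiring.Sum (CommutativeRing.semiring xor-∧-commutativeRing)
  using (sum-cong-≗; ∑-distrib-+; ∑-comm; *-distribˡ-sum; *-distribʳ-sum; sum-replicate-zero)

open ≡-Reasoning

private variable
  k l m n : ℕ

-- Multilinear alternating functions of columns and Laplace expansion.

infixl 6 _⊕_

_⊕_ : Vec Bool n → Vec Bool n → Vec Bool n
_⊕_ = zipWith _xor_

-- Over 𝔽₂ additivity in each column is the whole of multilinearity, as the only scalars are 0 and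
-- 1. The recursion fixes leading columns, which is how `laplace` consumes them.
Linear : (Vec (Vec Bool m) n → Bool) → Set
Linear {n = zero}  D = ⊤
Linear {n = suc n} D = (∀ c d C → D (c ⊕ d ∷ C) ≡ D (c ∷ C) xor D (d ∷ C))
                     × (∀ c → Linear (D ∘ (c ∷_)))

-- Only adjacent equal columns are considered: adjacent column additions
-- suffice for the elimination in `reduce`.
Alternating : (Vec (Vec Bool m) n → Bool) → Set
Alternating {n = zero}        D = ⊤
Alternating {n = suc zero}    D = ⊤
Alternating {n = suc (suc n)} D = (∀ c C → D (c ∷ c ∷ C) ≡ false)
                                × (∀ c → Alternating (D ∘ (c ∷_)))

linear-xor : ∀ n (D E : Vec (Vec Bool m) n → Bool) →
             Linear D → Linear E → Linear (λ C → D C xor E C)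
linear-xor zero    D E _         _         = tt
linear-xor (suc n) D E (D+ , D∷) (E+ , E∷) =
  (λ c d C → trans (cong₂ _xor_ (D+ c d C) (E+ c d C))
                   (xor-interchange (D (c ∷ C)) (D (d ∷ C)) (E (c ∷ C)) (E (d ∷ C)))) ,
  (λ c → linear-xor n (D ∘ (c ∷_)) (E ∘ (c ∷_)) (D∷ c) (E∷ c))

alternating-xor : ∀ n (D E : Vec (Vec Bool m) n → Bool) →
                  Alternating D → Alternating E → Alternating (λ C → D C xor E C)
alternating-xor zero          D E _         _         = tt
alternating-xor (suc zero)    D E _         _         = tt
alternating-xor (suc (suc n)) D E (D= , D∷) (E= , E∷) =
  (λ c C → cong₂ _xor_ (D= c C) (E= c C)) ,
  (λ c → alternating-xor (suc n) (D ∘ (c ∷_)) (E ∘ (c ∷_)) (D∷ c) (E∷ c))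

linear-tail : ∀ n a (D : Vec (Vec Bool m) n → Bool) →
              Linear D → Linear (λ C → a ∧ D (map tail C))
linear-tail zero    a D _         = tt
linear-tail (suc n) a D (D+ , D∷) =
  (λ { (_ ∷ c) (_ ∷ d) C → trans (cong (a ∧_) (D+ c d (map tail C)))
                                 (∧-distribˡ-xor a (D (c ∷ map tail C)) (D (d ∷ map tail C))) }) ,
  (λ c → linear-tail n a (D ∘ (tail c ∷_)) (D∷ (tail c)))

alternating-tail : ∀ n a (D : Vec (Vec Bool m) n → Bool) →
                   Alternating D → Alternating (λ C → a ∧ D (map tail C))
alternating-tail zero          a D _         = tt
alternating-tail (suc zero)    a D _         = tt
alternating-tail (suc (suc n)) a D (D= , D∷) =
  (λ c C → trans (cong (a ∧_) (D= (tail c) (map tail C))) (∧-zeroʳ a)) ,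
  (λ c → alternating-tail (suc n) a (D ∘ (tail c ∷_)) (D∷ (tail c)))

-- Laplace expansion along the first row, with `D` in place of the determinant of a minor. The
-- columns already passed are stored in `D` without their first entries. Hence `D` must be allowed
-- fewer columns than rows, and `m` and `n` are independent.
laplace : (Vec (Vec Bool m) n → Bool) → Vec (Vec Bool (suc m)) (suc n) → Bool
laplace {n = zero}  D (c ∷ []) = head c ∧ D []
laplace {n = suc n} D (c ∷ C)  = (head c ∧ D (map tail C)) xor laplace (D ∘ (tail c ∷_)) C

laplace-cong : ∀ {D E : Vec (Vec Bool m) n → Bool} → D ≗ E → laplace D ≗ laplace E
laplace-cong {n = zero}  D≗E ((a ∷ c) ∷ []) = cong (a ∧_) (D≗E [])
laplace-cong {n = suc n} D≗E ((a ∷ c) ∷ C)  =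
  cong₂ _xor_ (cong (a ∧_) (D≗E (map tail C))) (laplace-cong (D≗E ∘ (c ∷_)) C)

laplace-xor : ∀ (D E : Vec (Vec Bool m) n → Bool) C →
              laplace (λ X → D X xor E X) C ≡ laplace D C xor laplace E C
laplace-xor {n = zero}  D E ((a ∷ c) ∷ []) = ∧-distribˡ-xor a (D []) (E [])
laplace-xor {n = suc n} D E ((a ∷ c) ∷ C)  =
  trans (cong₂ _xor_ (∧-distribˡ-xor a (D (map tail C)) (E (map tail C)))
                     (laplace-xor (D ∘ (c ∷_)) (E ∘ (c ∷_)) C))
        (xor-interchange (a ∧ D (map tail C)) (a ∧ E (map tail C)) _ _)

laplace-false : ∀ {D : Vec (Vec Bool m) n → Bool} → (∀ C → D C ≡ false) →
                ∀ C → laplace D C ≡ false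
laplace-false {n = zero}  D≡0 ((a ∷ c) ∷ []) = trans (cong (a ∧_) (D≡0 [])) (∧-zeroʳ a)
laplace-false {n = suc n} D≡0 ((a ∷ c) ∷ C)  =
  cong₂ _xor_ (trans (cong (a ∧_) (D≡0 (map tail C))) (∧-zeroʳ a))
              (laplace-false (D≡0 ∘ (c ∷_)) C)

-- In the first column, one summand is additive through `head`, the other because `laplace` is
-- additive in `D`. In the later columns each summand is linear, the second by induction.
laplace-linear : ∀ n (D : Vec (Vec Bool m) n → Bool) → Linear D → Linear (laplace D)
laplace-linear zero    D _ =
  (λ { (a ∷ _) (b ∷ _) [] → ∧-distribʳ-xor (D []) a b }) , (λ _ → tt)
laplace-linear (suc n) D (D+ , D∷) =
  (λ { (a ∷ c) (b ∷ d) C →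
       trans (cong₂ _xor_ (∧-distribʳ-xor (D (map tail C)) a b)
                          (trans (laplace-cong (D+ c d) C)
                                 (laplace-xor (D ∘ (c ∷_)) (D ∘ (d ∷_)) C)))
             (xor-interchange (a ∧ D (map tail C)) (b ∧ D (map tail C)) _ _) }) ,
  (λ c → linear-xor (suc n) (λ C → head c ∧ D (map tail C)) (laplace (D ∘ (tail c ∷_)))
                   (linear-tail (suc n) (head c) D (D+ , D∷))
                   (laplace-linear n (D ∘ (tail c ∷_)) (D∷ (tail c))))

-- If the first two columns agree, the two terms that delete one of them are the same `t` and
-- cancel. The remaining terms keep both columns, so `D` vanishes there.
laplace-alternating : ∀ n (D : Vec (Vec Bool m) n → Bool) →
                      Alternating D → Alternating (laplace D)
laplace-alternating zero          D _ = tt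
laplace-alternating (suc zero)    D _ =
  (λ { (a ∷ c) [] → xor-same (a ∧ D (c ∷ [])) }) , (λ _ → tt)
laplace-alternating (suc (suc n)) D (D= , D∷) =
  (λ { (a ∷ c) C → let t = a ∧ D (c ∷ map tail C) in
       trans (cong (λ z → t xor (t xor z)) (laplace-false (D= c) C))
             (trans (cong (t xor_) (xor-identityʳ t)) (xor-same t)) }) ,
  (λ c → alternating-xor (suc (suc n)) (λ C → head c ∧ D (map tail C)) (laplace (D ∘ (tail c ∷_)))
                   (alternating-tail (suc (suc n)) (head c) D (D= , D∷))
                   (laplace-alternating (suc n) (D ∘ (tail c ∷_)) (D∷ (tail c))))

-- The determinant of the matrix with the given list of columns.
detᶜ : Vec (Vec Bool n) n → Bool
detᶜ {zero}  _ = true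
detᶜ {suc n} = laplace detᶜ

detᶜ-linear : ∀ n → Linear (detᶜ {n})
detᶜ-linear zero    = tt
detᶜ-linear (suc n) = laplace-linear n detᶜ (detᶜ-linear n)

detᶜ-alternating : ∀ n → Alternating (detᶜ {n})
detᶜ-alternating zero    = tt
detᶜ-alternating (suc n) = laplace-alternating n detᶜ (detᶜ-alternating n)

columns : Matrix m n → Vec (Vec Bool m) n
columns A = tabulate (λ j → tabulate (λ i → A i j))

-- Reconciles two ways to form a minor: `removeAt` drops column `j` at once, while `laplace`
-- collects the columns before `j` in `D`.
laplace-tabulate : ∀ (D : Vec (Vec Bool m) n → Bool) (a : Fin (suc n) → Bool) c →
                   sum (λ j → a j ∧ D (tabulate (removeAt c j)))
                   ≡ laplace D (tabulate (λ j → a j ∷ c j))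
laplace-tabulate {n = zero}  D a c = xor-identityʳ _
laplace-tabulate {n = suc n} D a c =
  cong₂ _xor_ (cong (λ C → a zero ∧ D C) (tabulate-∘ tail (λ j → a (suc j) ∷ c (suc j))))
              (laplace-tabulate (D ∘ (c zero ∷_)) (a ∘ suc) (c ∘ suc))

det≡detᶜ : ∀ {n} (A : Matrix n n) → det A ≡ detᶜ (columns A)
det≡detᶜ {zero}  A = refl
det≡detᶜ {suc n} A = trans
  (sum-cong-≗ (λ j → cong (A zero j ∧_) (det≡detᶜ (λ i → removeAt (A (suc i)) j))))
  (laplace-tabulate detᶜ (A zero) (λ j → tabulate (λ i → A (suc i) j)))

-- Column elimination and the determinant of a matrix with independent rows.

infix 4 _~_

data _~_ {m} : ∀ {n} → Vec (Vec Bool m) n → Vec (Vec Bool m) n → Set where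
  ~-refl  : ∀ {C : Vec (Vec Bool m) n} → C ~ C
  ~-trans : ∀ {C D E : Vec (Vec Bool m) n} → C ~ D → D ~ E → C ~ E
  ~-cons  : ∀ c {C D : Vec (Vec Bool m) n} → C ~ D → c ∷ C ~ c ∷ D
  addˡ    : ∀ c d (C : Vec (Vec Bool m) n) → c ∷ d ∷ C ~ c ⊕ d ∷ d ∷ C
  addʳ    : ∀ c d (C : Vec (Vec Bool m) n) → c ∷ d ∷ C ~ c ∷ c ⊕ d ∷ C

alternating-∷ : ∀ {n} {D : Vec (Vec Bool m) (suc n) → Bool} →
                Alternating D → ∀ c → Alternating (D ∘ (c ∷_))
alternating-∷ {n = zero}  _         _ = tt
alternating-∷ {n = suc n} (_  , D∷) c = D∷ c

-- By additivity, adding a column to its neighbour changes `D` by its value at a list with two equal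
-- adjacent columns, which is zero.
~-preserves : ∀ {D : Vec (Vec Bool m) n → Bool} → Linear D → Alternating D →
              ∀ {C C′} → C ~ C′ → D C ≡ D C′
~-preserves lin alt ~-refl        = refl
~-preserves lin alt (~-trans p q) = trans (~-preserves lin alt p) (~-preserves lin alt q)
~-preserves lin alt (~-cons c p)  =
  ~-preserves (proj₂ lin c) (alternating-∷ alt c) p
~-preserves {D = D} (D+ , _) (D= , _) (addˡ c d C) = sym (trans (D+ c d (d ∷ C))
  (trans (cong (D (c ∷ d ∷ C) xor_) (D= d C)) (xor-identityʳ _)))
~-preserves {D = D} (_ , D∷) (D= , _) (addʳ c d C) = sym (trans (proj₁ (D∷ c) c d C)
  (cong (_xor D (c ∷ d ∷ C)) (D= c C)))

dot : Vec Bool n → Vec Bool n → Bool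
dot []      []      = false
dot (a ∷ x) (b ∷ y) = (a ∧ b) xor dot x y

dot-⊕ : ∀ (x y z : Vec Bool n) → dot x (y ⊕ z) ≡ dot x y xor dot x z
dot-⊕ []      []      []      = refl
dot-⊕ (a ∷ x) (b ∷ y) (c ∷ z) =
  trans (cong₂ _xor_ (∧-distribˡ-xor a b c) (dot-⊕ x y z))
        (xor-interchange (a ∧ b) (a ∧ c) _ _)

dot-zeroˡ : ∀ (x : Vec Bool n) → dot (replicate n false) x ≡ false
dot-zeroˡ []      = refl
dot-zeroˡ (_ ∷ x) = dot-zeroˡ x

infix 4 _⟂_

_⟂_ : Vec Bool m → Vec (Vec Bool m) n → Set
x ⟂ C = All (λ c → dot x c ≡ false) C

-- An addition can be undone: the product with `c` is recovered from those with `c ⊕ d` and `d`. The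
-- direction is the one that carries orthogonality from the reduced columns back to the original
-- ones.
⟂-resp-~ : ∀ (x : Vec Bool m) {C D : Vec (Vec Bool m) n} → C ~ D → x ⟂ D → x ⟂ C
⟂-resp-~ x ~-refl        p       = p
⟂-resp-~ x (~-trans q r) p       = ⟂-resp-~ x q (⟂-resp-~ x r p)
⟂-resp-~ x (~-cons c q)  (e ∷ p) = e ∷ ⟂-resp-~ x q p
⟂-resp-~ x (addˡ c d C) (e ∷ f ∷ p) =
  trans (sym (xor-identityʳ _)) (trans (cong (dot x c xor_) (sym f)) (trans (sym (dot-⊕ x c d)) e))
  ∷ f ∷ p
⟂-resp-~ x (addʳ c d C) (e ∷ f ∷ p) =
  e ∷ trans (cong (_xor dot x d) (sym e)) (trans (sym (dot-⊕ x c d)) f) ∷ p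

ZeroRow : Vec (Vec Bool (suc m)) n → Set
ZeroRow = All (λ c → head c ≡ false)

-- Reducing the tail first brings its pivot next to the first column. If the first column starts
-- with `true`, adding it to that pivot clears the first entry there. If it starts with `false`, the
-- pivot is added to it beforehand.
reduce : (C : Vec (Vec Bool (suc m)) (suc n)) →
         ZeroRow C ⊎ ∃[ c ] ∃[ C′ ] (C ~ (true ∷ c) ∷ C′ × ZeroRow C′)
reduce ((false ∷ c) ∷ []) = inj₁ (refl ∷ [])
reduce ((true  ∷ c) ∷ []) = inj₂ (c , [] , ~-refl , [])
reduce ((a ∷ c) ∷ C@(_ ∷ _)) with reduce C
reduce ((false ∷ c) ∷ C@(_ ∷ _)) | inj₁ z = inj₁ (refl ∷ z)
reduce ((true  ∷ c) ∷ C@(_ ∷ _)) | inj₁ z = inj₂ (c , C , ~-refl , z)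
reduce ((true  ∷ c) ∷ C@(_ ∷ _)) | inj₂ (d , C′ , p , z) =
  inj₂ (_ , _ , ~-trans (~-cons _ p) (addʳ _ _ _) , refl ∷ z)
reduce ((false ∷ c) ∷ C@(_ ∷ _)) | inj₂ (d , C′ , p , z) =
  inj₂ (_ , _ , ~-trans (~-cons _ p) (~-trans (addˡ _ _ _) (addʳ _ _ _)) , refl ∷ z)

laplace-zeroRow : ∀ (D : Vec (Vec Bool m) n → Bool) {C} → ZeroRow C → laplace D C ≡ false
laplace-zeroRow {n = zero}  D {(_ ∷ _) ∷ []} (refl ∷ [])  = refl
laplace-zeroRow {n = suc n} D {(_ ∷ c) ∷ _}  (refl ∷ z)   = laplace-zeroRow (D ∘ (c ∷_)) z

unit-⟂ : ∀ {C : Vec (Vec Bool (suc m)) n} → ZeroRow C → true ∷ replicate m false ⟂ C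
unit-⟂ []                          = []
unit-⟂ {C = (_ ∷ c) ∷ _} (refl ∷ z) = dot-zeroˡ c ∷ unit-⟂ z

∷-⟂ : ∀ a (x : Vec Bool m) {C : Vec (Vec Bool (suc m)) n} →
      ZeroRow C → x ⟂ map tail C → a ∷ x ⟂ C
∷-⟂ a x               []         []      = []
∷-⟂ a x {(_ ∷ c) ∷ _} (refl ∷ z) (e ∷ p) =
  trans (cong (_xor dot x c) (∧-zeroʳ a)) e ∷ ∷-⟂ a x z p

laplace-pivot : ∀ (D : Vec (Vec Bool m) n → Bool) c {C} → ZeroRow C →
                laplace D ((true ∷ c) ∷ C) ≡ D (map tail C)
laplace-pivot {n = zero}  D c {[]} [] = refl
laplace-pivot {n = suc n} D c {C}  z  =
  trans (cong (D (map tail C) xor_) (laplace-zeroRow (D ∘ (c ∷_)) z)) (xor-identityʳ _)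

-- Induction on the size: elimination leaves the determinant unchanged and reduces it to the minor
-- at the pivot, whose rows are again independent.
detᶜ-independent : ∀ {n} (C : Vec (Vec Bool n) n) →
                   (∀ x → x ⟂ C → x ≡ replicate n false) → detᶜ C ≡ true
detᶜ-independent {zero}  C ind = refl
detᶜ-independent {suc n} C ind with reduce C
-- If the first row is zero, the first unit vector is orthogonal to all columns, against `ind`.
... | inj₁ z with () ← ind (true ∷ replicate n false) (unit-⟂ z)
... | inj₂ (c , C′ , p , z) =
  trans (~-preserves (detᶜ-linear (suc n)) (detᶜ-alternating (suc n)) p)
        (trans (laplace-pivot detᶜ c z) (detᶜ-independent (map tail C′) independent))
  where
  independent : ∀ x → x ⟂ map tail C′ → x ≡ replicate n false
  -- The first coordinate `dot x c` makes the product with the pivot column `true ∷ c` equal to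
  -- `dot x c xor dot x c`. The other columns start with `false`, so they do not see it.
  independent x x⟂C′ = cong tail (ind (dot x c ∷ x) (⟂-resp-~ (dot x c ∷ x) p
    (trans (cong (_xor dot x c) (∧-identityʳ (dot x c))) (xor-same (dot x c)) ∷ ∷-⟂ (dot x c) x z x⟂C′)))

-- Matrix algebra over 𝔽₂.

·-cong : {A A′ : Matrix l m} {B B′ : Matrix m n} →
         A ≈ᴹ A′ → B ≈ᴹ B′ → A ·ᴹ B ≈ᴹ A′ ·ᴹ B′
·-cong A≈ B≈ i k = sum-cong-≗ (λ j → cong₂ _∧_ (A≈ i j) (B≈ j k))

·-congˡ : (A : Matrix l m) {B B′ : Matrix m n} → B ≈ᴹ B′ → A ·ᴹ B ≈ᴹ A ·ᴹ B′
·-congˡ A = ·-cong {A = A} (λ _ _ → refl)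

·-congʳ : {A A′ : Matrix l m} (B : Matrix m n) → A ≈ᴹ A′ → A ·ᴹ B ≈ᴹ A′ ·ᴹ B
·-congʳ B A≈ = ·-cong {B = B} A≈ (λ _ _ → refl)

·-assoc : (A : Matrix k l) (B : Matrix l m) (C : Matrix m n) →
          A ·ᴹ B ·ᴹ C ≈ᴹ A ·ᴹ (B ·ᴹ C)
·-assoc A B C i j = begin
  sum (λ q → sum (λ p → A i p ∧ B p q) ∧ C q j)
    ≡⟨ sum-cong-≗ (λ q → *-distribʳ-sum (C q j) (λ p → A i p ∧ B p q)) ⟩
  sum (λ q → sum (λ p → (A i p ∧ B p q) ∧ C q j))
    ≡⟨ ∑-comm (λ q p → (A i p ∧ B p q) ∧ C q j) ⟩
  sum (λ p → sum (λ q → (A i p ∧ B p q) ∧ C q j))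
    ≡⟨ sum-cong-≗ (λ p → sum-cong-≗ (λ q → ∧-assoc (A i p) (B p q) (C q j))) ⟩
  sum (λ p → sum (λ q → A i p ∧ (B p q ∧ C q j)))
    ≡⟨ sum-cong-≗ (λ p → *-distribˡ-sum (A i p) (λ q → B p q ∧ C q j)) ⟨
  sum (λ p → A i p ∧ sum (λ q → B p q ∧ C q j)) ∎

·-distribˡ-+ : (A : Matrix l m) (B C : Matrix m n) →
               A ·ᴹ (B +ᴹ C) ≈ᴹ A ·ᴹ B +ᴹ A ·ᴹ C
·-distribˡ-+ A B C i k =
  trans (sum-cong-≗ (λ j → ∧-distribˡ-xor (A i j) (B j k) (C j k)))
        (∑-distrib-+ (λ j → A i j ∧ B j k) (λ j → A i j ∧ C j k))

·-distribʳ-+ : (A B : Matrix l m) (C : Matrix m n) →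
               (A +ᴹ B) ·ᴹ C ≈ᴹ A ·ᴹ C +ᴹ B ·ᴹ C
·-distribʳ-+ A B C i k =
  trans (sum-cong-≗ (λ j → ∧-distribʳ-xor (C j k) (A i j) (B i j)))
        (∑-distrib-+ (λ j → A i j ∧ C j k) (λ j → B i j ∧ C j k))

1ᴹ-sym : ∀ (i j : Fin n) → 1ᴹ i j ≡ 1ᴹ j i
1ᴹ-sym zero    zero    = refl
1ᴹ-sym zero    (suc j) = refl
1ᴹ-sym (suc i) zero    = refl
1ᴹ-sym (suc i) (suc j) = 1ᴹ-sym i j

sum-1ᴹ : ∀ (i : Fin n) (f : Fin n → Bool) → sum (λ j → 1ᴹ i j ∧ f j) ≡ f i
sum-1ᴹ {suc n} zero    f = trans (cong (f zero xor_) (sum-replicate-zero n)) (xor-identityʳ (f zero))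
sum-1ᴹ (suc i) f = sum-1ᴹ i (f ∘ suc)

·-identityˡ : (A : Matrix m n) → 1ᴹ ·ᴹ A ≈ᴹ A
·-identityˡ A i j = sum-1ᴹ i (λ k → A k j)

·-identityʳ : (A : Matrix m n) → A ·ᴹ 1ᴹ ≈ᴹ A
·-identityʳ A i j = trans
  (sum-cong-≗ (λ k → trans (∧-comm (A i k) (1ᴹ k j)) (cong (_∧ A i k) (1ᴹ-sym k j))))
  (sum-1ᴹ j (A i))

·-zeroʳ : (A : Matrix l m) {B : Matrix m n} → (∀ i j → B i j ≡ false) → ∀ i j → (A ·ᴹ B) i j ≡ false
·-zeroʳ {m = m} A B≡0 i j = trans
  (sum-cong-≗ (λ k → trans (cong (A i k ∧_) (B≡0 k j)) (∧-zeroʳ (A i k))))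
  (sum-replicate-zero m)

-- Invertible matrices have determinant 1.

dot-tabulate : ∀ (x : Vec Bool n) f → dot x (tabulate f) ≡ sum (λ i → lookup x i ∧ f i)
dot-tabulate []      f = refl
dot-tabulate (a ∷ x) f = cong ((a ∧ f zero) xor_) (dot-tabulate x (f ∘ suc))

lookup-false : ∀ (x : Vec Bool n) → (∀ i → lookup x i ≡ false) → x ≡ replicate n false
lookup-false []      _  = refl
lookup-false (_ ∷ x) eq = cong₂ _∷_ (eq zero) (lookup-false x (eq ∘ suc))

-- A row vector with `x A = 0` satisfies `x = x A B = 0`, so the rows of `A` are independent.
inverse⇒det : (A B : Matrix n n) → A ·ᴹ B ≈ᴹ 1ᴹ → det A ≡ true
inverse⇒det {n} A B AB≈1 = trans (det≡detᶜ A) (detᶜ-independent (columns A) independent)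
  where
  independent : ∀ x → x ⟂ columns A → x ≡ replicate n false
  independent x x⟂A = lookup-false x (λ i → begin
    lookup x i            ≡⟨ ·-identityʳ X zero i ⟨
    (X ·ᴹ 1ᴹ) zero i      ≡⟨ ·-congˡ X AB≈1 zero i ⟨
    (X ·ᴹ (A ·ᴹ B)) zero i ≡⟨ ·-assoc X A B zero i ⟨
    (X ·ᴹ A ·ᴹ B) zero i  ≡⟨ ·-congʳ B XA≈0 zero i ⟩
    sum {n} (λ _ → false)     ≡⟨ sum-replicate-zero n ⟩
    false                 ∎)
    where
    X : Matrix 1 n
    X _ = lookup x
    XA≈0 : X ·ᴹ A ≈ᴹ (λ _ _ → false)
    XA≈0 _ j = trans (sym (dot-tabulate x (λ i → A i j))) (All-tabulate⁻ x⟂A j)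

-- Block decomposition along a subset and its complement.

sum-split : ∀ (X : Subset n) f →
            sum f ≡ sum (f ∘ element X) xor sum (f ∘ element (∁ X))
sum-split []            f = refl
sum-split (inside  ∷ X) f =
  trans (cong (f zero xor_) (sum-split X (f ∘ suc))) (sym (xor-assoc (f zero) _ _))
sum-split (outside ∷ X) f =
  trans (cong (f zero xor_) (sum-split X (f ∘ suc)))
        (trans (sym (xor-assoc (f zero) A _))
        (trans (cong (_xor B) (xor-comm (f zero) A)) (xor-assoc A (f zero) _)))
  where
  A = sum (f ∘ suc ∘ element X)
  B = sum (f ∘ suc ∘ element (∁ X))

data Split (X : Subset n) : Fin n → Set where
  in-X  : ∀ i → Split X (element X i)
  in-∁X : ∀ i → Split X (element (∁ X) i)

split : ∀ (X : Subset n) v → Split X v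
split (inside  ∷ X) zero    = in-X zero
split (outside ∷ X) zero    = in-∁X zero
split (inside  ∷ X) (suc v) with split X v
... | in-X i  = in-X (suc i)
... | in-∁X i = in-∁X i
split (outside ∷ X) (suc v) with split X v
... | in-X i  = in-X i
... | in-∁X i = in-∁X (suc i)

lookup-element : ∀ (X : Subset n) i → lookup X (element X i) ≡ true
lookup-element (inside  ∷ X) zero    = refl
lookup-element (inside  ∷ X) (suc i) = lookup-element X i
lookup-element (outside ∷ X) i       = lookup-element X i

lookup-element-∁ : ∀ (X : Subset n) i → lookup X (element (∁ X) i) ≡ false
lookup-element-∁ (inside  ∷ X) i       = lookup-element-∁ X i
lookup-element-∁ (outside ∷ X) zero    = refl
lookup-element-∁ (outside ∷ X) (suc i) = lookup-element-∁ X i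

1ᴹ-diagonal-block : ∀ (X : Subset n) → 1ᴹ [ X , X ] ≈ᴹ 1ᴹ
1ᴹ-diagonal-block (inside  ∷ X) zero    zero    = refl
1ᴹ-diagonal-block (inside  ∷ X) zero    (suc j) = refl
1ᴹ-diagonal-block (inside  ∷ X) (suc i) zero    = refl
1ᴹ-diagonal-block (inside  ∷ X) (suc i) (suc j) = 1ᴹ-diagonal-block X i j
1ᴹ-diagonal-block (outside ∷ X) i       j       = 1ᴹ-diagonal-block X i j

1ᴹ-off-diagonal-block : ∀ (X : Subset n) i j → (1ᴹ [ X , ∁ X ]) i j ≡ false
1ᴹ-off-diagonal-block (inside  ∷ X) zero    j       = refl
1ᴹ-off-diagonal-block (inside  ∷ X) (suc i) j       = 1ᴹ-off-diagonal-block X i j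
1ᴹ-off-diagonal-block (outside ∷ X) i       zero    = refl
1ᴹ-off-diagonal-block (outside ∷ X) i       (suc j) = 1ᴹ-off-diagonal-block X i j

rows : (X : Subset n) → Matrix n k → Matrix ∣ X ∣ k
rows X M = M ∘ element X

rows-· : ∀ (X Y : Subset n) (A : Matrix n n) (M : Matrix n k) →
         rows X (A ·ᴹ M) ≈ᴹ A [ X , Y ] ·ᴹ rows Y M +ᴹ A [ X , ∁ Y ] ·ᴹ rows (∁ Y) M
rows-· X Y A M i j = sum-split Y (λ v → A (element X i) v ∧ M v j)

-- The action of loop complementation and pivot on L(G).

xor-cancelʳ : ∀ a b → (a xor b) xor b ≡ a
xor-cancelʳ a b = trans (xor-assoc a b b) (trans (cong (a xor_) (xor-same b)) (xor-identityʳ a))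

xor-cancel-middle : ∀ a b c → (a xor b) xor (c xor b) ≡ a xor c
xor-cancel-middle a b c = trans (xor-interchange a b c b)
  (trans (cong ((a xor c) xor_) (xor-same b)) (xor-identityʳ _))

addIf swapIf : Bool → Bool × Bool → Bool × Bool
addIf  b (x , y) = x , y xor (b ∧ x)
swapIf b p       = if b then swap p else p

-- T lists pairs (x , y) of vectors columnwise; T On G says that they all lie in
-- the subspace y = G x.
infix 4 _On_

record _On_ {n k} (T : Fin n → Fin k → Bool × Bool) (G : Graph n) : Set where
  constructor on
  field
    off : (λ i j → proj₂ (T i j)) ≈ᴹ adj G ·ᴹ (λ i j → proj₁ (T i j))

open _On_

On-resp : ∀ {T U : Fin n → Fin k → Bool × Bool} {G} → (∀ i j → T i j ≡ U i j) → T On G → U On G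
On-resp {G = G} T≡U T-on = on λ i j → trans (sym (cong proj₂ (T≡U i j))) (trans (off T-on i j)
  (·-congˡ (adj G) (λ i j → cong proj₁ (T≡U i j)) i j))

On-≈ : ∀ {T : Fin n → Fin k → Bool × Bool} {G} H → H ≈ G → T On G → T On H
On-≈ {T = T} H H≈G T-on = on λ i j →
  trans (off T-on i j) (sym (·-congʳ (λ i j → proj₁ (T i j)) H≈G i j))

diagonal-· : ∀ (X : Subset n) (M : Matrix n k) i j → (diagonal X ·ᴹ M) i j ≡ lookup X i ∧ M i j
diagonal-· X M i j = trans (sum-cong-≗ (λ v → ∧-assoc (1ᴹ i v) (lookup X i) (M v j)))
                           (sum-1ᴹ i (λ v → lookup X i ∧ M v j))

On-+ᴸ : ∀ {T : Fin n → Fin k → Bool × Bool} {G} X → T On G →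
        (λ i j → addIf (lookup X i) (T i j)) On G +ᴸ X
On-+ᴸ {T = T} {G} X T-on = on λ i j → begin
  proj₂ (T i j) xor (lookup X i ∧ M i j)         ≡⟨ cong₂ _xor_ (off T-on i j) (sym (diagonal-· X M i j)) ⟩
  (adj G ·ᴹ M) i j xor (diagonal X ·ᴹ M) i j     ≡⟨ ·-distribʳ-+ (adj G) (diagonal X) M i j ⟨
  ((adj G +ᴹ diagonal X) ·ᴹ M) i j               ∎
  where
  M : Matrix _ _
  M i j = proj₁ (T i j)

-- Since `P` is invertible, `N₁ = P M₁ + Q M₂` can be solved for `M₁`, and the solution substituted
-- into `N₂ = R M₁ + S M₂`. The coefficients of `N₁` and `M₂` that result are the four blocks of the
-- pivot.
On-pivot : ∀ {T : Fin n → Fin k → Bool × Bool} {G H} X → IsPivot G X H → T On G →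
           (λ i j → swapIf (lookup X i) (T i j)) On H
On-pivot {n} {k} {T} {G} {H} X pivot T-on = on λ v j → result j (split X v)
  where
  open IsPivot pivot
  open IsInverse P⁻¹-inverse
  M N M′ N′ : Matrix n k
  M i j = proj₁ (T i j)
  N i j = proj₂ (T i j)
  M′ i j = proj₁ (swapIf (lookup X i) (T i j))
  N′ i j = proj₂ (swapIf (lookup X i) (T i j))

  M₁ = rows X M
  N₁ = rows X N
  M₂ = rows (∁ X) M
  N₂ = rows (∁ X) N

  N₁≈ : N₁ ≈ᴹ P ·ᴹ M₁ +ᴹ Q ·ᴹ M₂
  N₁≈ i j = trans (off T-on (element X i) j) (rows-· X X (adj G) M i j)

  N₂≈ : N₂ ≈ᴹ R ·ᴹ M₁ +ᴹ S ·ᴹ M₂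
  N₂≈ i j = trans (off T-on (element (∁ X) i) j) (rows-· (∁ X) X (adj G) M i j)

  M′₁≈ : rows X M′ ≈ᴹ N₁
  M′₁≈ i j rewrite lookup-element X i = refl
  N′₁≈ : rows X N′ ≈ᴹ M₁
  N′₁≈ i j rewrite lookup-element X i = refl
  M′₂≈ : rows (∁ X) M′ ≈ᴹ M₂
  M′₂≈ i j rewrite lookup-element-∁ X i = refl
  N′₂≈ : rows (∁ X) N′ ≈ᴹ N₂
  N′₂≈ i j rewrite lookup-element-∁ X i = refl

  P⁻¹N₁ : P⁻¹ ·ᴹ N₁ ≈ᴹ M₁ +ᴹ P⁻¹ ·ᴹ Q ·ᴹ M₂
  P⁻¹N₁ i j = begin
    (P⁻¹ ·ᴹ N₁) i j
      ≡⟨ ·-congˡ P⁻¹ N₁≈ i j ⟩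
    (P⁻¹ ·ᴹ (P ·ᴹ M₁ +ᴹ Q ·ᴹ M₂)) i j
      ≡⟨ ·-distribˡ-+ P⁻¹ (P ·ᴹ M₁) (Q ·ᴹ M₂) i j ⟩
    (P⁻¹ ·ᴹ (P ·ᴹ M₁) +ᴹ P⁻¹ ·ᴹ (Q ·ᴹ M₂)) i j
      ≡⟨ cong₂ _xor_ (·-assoc P⁻¹ P M₁ i j) (·-assoc P⁻¹ Q M₂ i j) ⟨
    (P⁻¹ ·ᴹ P ·ᴹ M₁ +ᴹ P⁻¹ ·ᴹ Q ·ᴹ M₂) i j
      ≡⟨ cong (_xor (P⁻¹ ·ᴹ Q ·ᴹ M₂) i j) (trans (·-congʳ M₁ inverseˡ i j) (·-identityˡ M₁ i j)) ⟩
    (M₁ +ᴹ P⁻¹ ·ᴹ Q ·ᴹ M₂) i j ∎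

  block : ∀ Y → rows Y (adj H ·ᴹ M′) ≈ᴹ adj H [ Y , X ] ·ᴹ N₁ +ᴹ adj H [ Y , ∁ X ] ·ᴹ M₂
  block Y i j = trans (rows-· Y X (adj H) M′ i j)
    (cong₂ _xor_ (·-congˡ (adj H [ Y , X ]) M′₁≈ i j) (·-congˡ (adj H [ Y , ∁ X ]) M′₂≈ i j))

  upper : rows X N′ ≈ᴹ rows X (adj H ·ᴹ M′)
  upper i j = begin
    rows X N′ i j
      ≡⟨ N′₁≈ i j ⟩
    M₁ i j
      ≡⟨ xor-cancelʳ (M₁ i j) ((P⁻¹ ·ᴹ Q ·ᴹ M₂) i j) ⟨
    (M₁ +ᴹ P⁻¹ ·ᴹ Q ·ᴹ M₂ +ᴹ P⁻¹ ·ᴹ Q ·ᴹ M₂) i j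
      ≡⟨ cong (_xor (P⁻¹ ·ᴹ Q ·ᴹ M₂) i j) (P⁻¹N₁ i j) ⟨
    (P⁻¹ ·ᴹ N₁ +ᴹ P⁻¹ ·ᴹ Q ·ᴹ M₂) i j
      ≡⟨ cong₂ _xor_ (·-congʳ N₁ upper-left i j) (·-congʳ M₂ upper-right i j) ⟨
    (adj H [ X , X ] ·ᴹ N₁ +ᴹ adj H [ X , ∁ X ] ·ᴹ M₂) i j
      ≡⟨ block X i j ⟨
    rows X (adj H ·ᴹ M′) i j ∎

  lower : rows (∁ X) N′ ≈ᴹ rows (∁ X) (adj H ·ᴹ M′)
  lower i j = begin
    rows (∁ X) N′ i j
      ≡⟨ N′₂≈ i j ⟩
    N₂ i j
      ≡⟨ N₂≈ i j ⟩
    (R ·ᴹ M₁ +ᴹ S ·ᴹ M₂) i j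
      -- `RP⁻¹QM₂` is added twice, which changes nothing in characteristic 2. One copy completes
      -- `R M₁` to `R P⁻¹ N₁`, the other completes `S M₂` to `(S + R P⁻¹ Q) M₂`.
      ≡⟨ xor-cancel-middle ((R ·ᴹ M₁) i j) (RP⁻¹QM₂ i j) ((S ·ᴹ M₂) i j) ⟨
    (R ·ᴹ M₁ +ᴹ RP⁻¹QM₂ +ᴹ (S ·ᴹ M₂ +ᴹ RP⁻¹QM₂)) i j
      ≡⟨ cong₂ _xor_ RP⁻¹N₁ S+RP⁻¹Q ⟨
    (R ·ᴹ P⁻¹ ·ᴹ N₁ +ᴹ (S +ᴹ R ·ᴹ P⁻¹ ·ᴹ Q) ·ᴹ M₂) i j
      ≡⟨ cong₂ _xor_ (·-congʳ N₁ lower-left i j) (·-congʳ M₂ lower-right i j) ⟨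
    (adj H [ ∁ X , X ] ·ᴹ N₁ +ᴹ adj H [ ∁ X , ∁ X ] ·ᴹ M₂) i j
      ≡⟨ block (∁ X) i j ⟨
    rows (∁ X) (adj H ·ᴹ M′) i j ∎
    where
    RP⁻¹QM₂ : Matrix ∣ ∁ X ∣ k
    RP⁻¹QM₂ = R ·ᴹ (P⁻¹ ·ᴹ Q ·ᴹ M₂)

    RP⁻¹N₁ : (R ·ᴹ P⁻¹ ·ᴹ N₁) i j ≡ (R ·ᴹ M₁ +ᴹ RP⁻¹QM₂) i j
    RP⁻¹N₁ = trans (·-assoc R P⁻¹ N₁ i j) (trans (·-congˡ R P⁻¹N₁ i j)
      (·-distribˡ-+ R M₁ (P⁻¹ ·ᴹ Q ·ᴹ M₂) i j))

    S+RP⁻¹Q : ((S +ᴹ R ·ᴹ P⁻¹ ·ᴹ Q) ·ᴹ M₂) i j ≡ (S ·ᴹ M₂ +ᴹ RP⁻¹QM₂) i j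
    S+RP⁻¹Q = trans (·-distribʳ-+ S (R ·ᴹ P⁻¹ ·ᴹ Q) M₂ i j) (cong ((S ·ᴹ M₂) i j xor_)
      (trans (·-congʳ M₂ (·-assoc R P⁻¹ Q) i j) (·-assoc R (P⁻¹ ·ᴹ Q) M₂ i j)))

  result : ∀ {v} j → Split X v → N′ v j ≡ (adj H ·ᴹ M′) v j
  result j (in-X i)  = upper i j
  result j (in-∁X i) = lower i j

-- A converse of `On-pivot`. After the swap, `M′` has block rows `(P , Q)` and `(0 , 1)`, and `N′`
-- has `(1 , 0)` and `(R , S)`. Reading `N′ = H M′` by blocks gives `H₁₁ P = 1`, `H₂₁ P = R`,
-- `H₁₂ = H₁₁ Q` and `H₂₂ = S + H₂₁ Q`; thus `H₁₁` is the inverse of `P`.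
On⇒IsPivot : ∀ {G H : Graph n} X →
             (λ i j → swapIf (lookup X i) (1ᴹ i j , adj G i j)) On H → IsPivot G X H
On⇒IsPivot {n} {G} {H} X T-on = record
  { applicable  = inverse⇒det P H₁₁ PH₁₁≈1
  ; P⁻¹         = H₁₁
  ; P⁻¹-inverse = record { inverseˡ = H₁₁P≈1 ; inverseʳ = PH₁₁≈1 }
  ; upper-left  = λ _ _ → refl
  ; upper-right = H₁₂≈H₁₁Q
  ; lower-left  = H₂₁≈RH₁₁
  ; lower-right = λ i j → trans (H₂₂≈S+H₂₁Q i j) (cong (S i j xor_) (·-congʳ Q H₂₁≈RH₁₁ i j))
  }
  where
  M′ N′ : Matrix n n
  M′ i j = proj₁ (swapIf (lookup X i) (1ᴹ i j , adj G i j))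
  N′ i j = proj₂ (swapIf (lookup X i) (1ᴹ i j , adj G i j))
  A = adj G
  P = A [ X , X ]
  Q = A [ X , ∁ X ]
  R = A [ ∁ X , X ]
  S = A [ ∁ X , ∁ X ]
  H₁₁ = adj H [ X , X ]
  H₁₂ = adj H [ X , ∁ X ]
  H₂₁ = adj H [ ∁ X , X ]
  H₂₂ = adj H [ ∁ X , ∁ X ]

  M′₁≈ : rows X M′ ≈ᴹ rows X A
  M′₁≈ i j rewrite lookup-element X i = refl
  N′₁≈ : rows X N′ ≈ᴹ rows X 1ᴹ
  N′₁≈ i j rewrite lookup-element X i = refl
  M′₂≈ : rows (∁ X) M′ ≈ᴹ rows (∁ X) 1ᴹ
  M′₂≈ i j rewrite lookup-element-∁ X i = refl
  N′₂≈ : rows (∁ X) N′ ≈ᴹ rows (∁ X) A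
  N′₂≈ i j rewrite lookup-element-∁ X i = refl

  block : ∀ Y → rows Y N′ ≈ᴹ adj H [ Y , X ] ·ᴹ rows X A +ᴹ adj H [ Y , ∁ X ] ·ᴹ rows (∁ X) 1ᴹ
  block Y i j = trans (off T-on (element Y i) j) (trans (rows-· Y X (adj H) M′ i j)
    (cong₂ _xor_ (·-congˡ (adj H [ Y , X ]) M′₁≈ i j) (·-congˡ (adj H [ Y , ∁ X ]) M′₂≈ i j)))

  left : ∀ Y → adj H [ Y , X ] ·ᴹ P ≈ᴹ N′ [ Y , X ]
  left Y i j = sym (trans (block Y i (element X j)) (trans
    (cong ((adj H [ Y , X ] ·ᴹ P) i j xor_) (·-zeroʳ (adj H [ Y , ∁ X ])
      (λ p q → trans (1ᴹ-sym (element (∁ X) p) (element X q)) (1ᴹ-off-diagonal-block X q p)) i j))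
    (xor-identityʳ _)))

  right : ∀ Y → adj H [ Y , ∁ X ] ≈ᴹ N′ [ Y , ∁ X ] +ᴹ adj H [ Y , X ] ·ᴹ Q
  right Y i j = begin
    B i j                                ≡⟨ ·-identityʳ B i j ⟨
    (B ·ᴹ 1ᴹ) i j                        ≡⟨ ·-congˡ B (1ᴹ-diagonal-block (∁ X)) i j ⟨
    (B ·ᴹ 1ᴹ [ ∁ X , ∁ X ]) i j          ≡⟨ xor-cancelʳ _ ((C ·ᴹ Q) i j) ⟨
    (B ·ᴹ 1ᴹ [ ∁ X , ∁ X ] +ᴹ C ·ᴹ Q +ᴹ C ·ᴹ Q) i j
      ≡⟨ cong (_xor (C ·ᴹ Q) i j) (xor-comm _ ((C ·ᴹ Q) i j)) ⟩
    (C ·ᴹ Q +ᴹ B ·ᴹ 1ᴹ [ ∁ X , ∁ X ] +ᴹ C ·ᴹ Q) i j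
      ≡⟨ cong (_xor (C ·ᴹ Q) i j) (block Y i (element (∁ X) j)) ⟨
    (N′ [ Y , ∁ X ] +ᴹ C ·ᴹ Q) i j       ∎
    where
    B = adj H [ Y , ∁ X ]
    C = adj H [ Y , X ]

  H₁₁P≈1 : H₁₁ ·ᴹ P ≈ᴹ 1ᴹ
  H₁₁P≈1 i j = trans (left X i j) (trans (N′₁≈ i (element X j)) (1ᴹ-diagonal-block X i j))

  -- Transposing `H₁₁ P = 1` gives the right inverse, as both graphs are symmetric.
  PH₁₁≈1 : P ·ᴹ H₁₁ ≈ᴹ 1ᴹ
  PH₁₁≈1 i j = begin
    sum (λ k → P i k ∧ H₁₁ k j)  ≡⟨ sum-cong-≗ (λ k → trans (∧-comm (P i k) (H₁₁ k j))
                                      (cong₂ _∧_ (symmetric H _ _) (symmetric G _ _))) ⟩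
    sum (λ k → H₁₁ j k ∧ P k i)  ≡⟨ H₁₁P≈1 j i ⟩
    1ᴹ j i                       ≡⟨ 1ᴹ-sym j i ⟩
    1ᴹ i j                       ∎

  H₁₂≈H₁₁Q : H₁₂ ≈ᴹ H₁₁ ·ᴹ Q
  H₁₂≈H₁₁Q i j = trans (right X i j) (cong (_xor (H₁₁ ·ᴹ Q) i j)
    (trans (N′₁≈ i (element (∁ X) j)) (1ᴹ-off-diagonal-block X i j)))

  H₂₁≈RH₁₁ : H₂₁ ≈ᴹ R ·ᴹ H₁₁
  H₂₁≈RH₁₁ i j = begin
    H₂₁ i j                   ≡⟨ ·-identityʳ H₂₁ i j ⟨
    (H₂₁ ·ᴹ 1ᴹ) i j           ≡⟨ ·-congˡ H₂₁ PH₁₁≈1 i j ⟨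
    (H₂₁ ·ᴹ (P ·ᴹ H₁₁)) i j   ≡⟨ ·-assoc H₂₁ P H₁₁ i j ⟨
    (H₂₁ ·ᴹ P ·ᴹ H₁₁) i j     ≡⟨ ·-congʳ H₁₁ (λ i j → trans (left (∁ X) i j) (N′₂≈ i (element X j))) i j ⟩
    (R ·ᴹ H₁₁) i j            ∎

  H₂₂≈S+H₂₁Q : H₂₂ ≈ᴹ S +ᴹ H₂₁ ·ᴹ Q
  H₂₂≈S+H₂₁Q i j = trans (right (∁ X) i j)
    (cong (_xor (H₂₁ ·ᴹ Q) i j) (N′₂≈ i (element (∁ X) j)))

-- Normal forms in GL₂(𝔽₂).

-- Representatives of the six elements of GL₂(𝔽₂): the Bruhat decomposition.
record Normal : Set where
  constructor normal
  field
    x y z : Bool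
    x⇒y   : x ≡ true → y ≡ true

open Normal

⟦_⟧ : Normal → Bool × Bool → Bool × Bool
⟦ w ⟧ p = addIf (z w) (swapIf (y w) (addIf (x w) p))

addIf-addIf : ∀ a b p → addIf a (addIf b p) ≡ addIf (b xor a) p
addIf-addIf a b (u , v) = cong (u ,_) (trans (xor-assoc v (b ∧ u) (a ∧ u))
  (cong (v xor_) (sym (∧-distribʳ-xor u b a))))

addIf-normal : ∀ b w → ∃[ w′ ] ∀ p → ⟦ w′ ⟧ p ≡ addIf b (⟦ w ⟧ p)
addIf-normal b (normal x y z x⇒y) =
  normal x y (z xor b) x⇒y , λ p → sym (addIf-addIf b z (swapIf y (addIf x p)))

-- If `y` is false, so is `x`, and a swap after `addᶻ` is already normal. If `y` is true and `z`
-- false, the two swaps cancel. If both are true, `swap ∘ add ∘ swap = add ∘ swap ∘ add`, and the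
-- new inner `add` merges with `addˣ`, which flips `x`.
swapIf-normal : ∀ b w → ∃[ w′ ] ∀ p → ⟦ w′ ⟧ p ≡ swapIf b (⟦ w ⟧ p)
swapIf-normal false w = w , λ _ → refl
swapIf-normal true (normal true  false z x⇒y) with () ← x⇒y refl
swapIf-normal true (normal false false z _) =
  normal z true false (λ _ → refl) ,
  λ (u , v) → cong₂ _,_ (cong (_xor (z ∧ u)) (sym (xor-identityʳ v))) (xor-identityʳ u)
swapIf-normal true (normal x true false _) =
  normal false false x (λ ()) ,
  λ (u , v) → cong₂ _,_ (sym (xor-identityʳ u)) (cong (_xor (x ∧ u)) (xor-identityʳ v))
-- (swap ∘ add)³ = id.
swapIf-normal true (normal x true true _) =
  normal (not x) true true (λ _ → refl) , braid x
  where
  braid : ∀ x p → addIf true (swapIf true (addIf (not x) p))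
                  ≡ swapIf true (addIf true (swapIf true (addIf x p)))
  braid false (false , false) = refl
  braid false (false , true)  = refl
  braid false (true  , false) = refl
  braid false (true  , true)  = refl
  braid true  (false , false) = refl
  braid true  (false , true)  = refl
  braid true  (true  , false) = refl
  braid true  (true  , true)  = refl

-- Sequences of operations and the choice of X, Y and Z.

-- The columns are the pairs of a unit vector and its image under `adj G`, a basis of L(G). To carry
-- L(G) into L(H) it is enough to carry these.
graph : Graph n → Fin n → Fin n → Bool × Bool
graph G i j = 1ᴹ i j , adj G i j

record _⟿_ (G H : Graph n) : Set where
  constructor via
  field
    w       : Fin n → Normal
    carries : (λ i j → ⟦ w i ⟧ (graph G i j)) On H

⟿-refl : ∀ (G : Graph n) → G ⟿ G
⟿-refl G = via (λ _ → normal false false false (λ ())) (on λ i j → begin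
  (adj G i j xor false) xor false  ≡⟨ trans (xor-identityʳ _) (xor-identityʳ _) ⟩
  adj G i j                        ≡⟨ ·-identityʳ (adj G) i j ⟨
  (adj G ·ᴹ 1ᴹ) i j                ∎)

⟿-pivot : ∀ {G K H : Graph n} X → G ⟿ K → IsPivot K X H → G ⟿ H
⟿-pivot {G = G} X (via w carries) pivot =
  via (λ i → proj₁ (swapIf-normal (lookup X i) (w i)))
      (On-resp (λ i j → sym (proj₂ (swapIf-normal (lookup X i) (w i)) (graph G i j)))
               (On-pivot X pivot carries))

⟿-loop : ∀ {G K H : Graph n} X → G ⟿ K → H ≈ K +ᴸ X → G ⟿ H
⟿-loop {G = G} {H = H} X (via w carries) H≈ =
  via (λ i → proj₁ (addIf-normal (lookup X i) (w i)))
      (On-resp (λ i j → sym (proj₂ (addIf-normal (lookup X i) (w i)) (graph G i j)))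
               (On-≈ H H≈ (On-+ᴸ X carries)))

⟿-step : ∀ {G K H : Graph n} {o} → G ⟿ K → K ⟨ o ⟩⇒ H → G ⟿ H
⟿-step r (local _ pivot)      = ⟿-pivot _ r pivot
⟿-step r (edge _ _ _ _ pivot) = ⟿-pivot _ r pivot
⟿-step r (loop {X} H≈)        = ⟿-loop X r H≈

⟿-steps : ∀ {G K H : Graph n} {φ} → G ⟿ K → K ⟨ φ ⟩⇒* H → G ⟿ H
⟿-steps {H = H} (via w carries) ([] H≈K) = via w (On-≈ H H≈K carries)
⟿-steps r (step ∷ steps) = ⟿-steps (⟿-step r step) steps

corollary15 : ∀ (n : ℕ) (G : Graph n) (φ : List (Operation n)) (Gφ : Graph n) →
              G ⟨ φ ⟩⇒* Gφ →
              ∃[ X ] ∃[ Y ] ∃[ Z ] ∃[ H ]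
                (X ⊆ Y × IsPivot (G +ᴸ X) Y H × Gφ ≈ H +ᴸ Z)
corollary15 n G φ Gφ steps with via w carries ← ⟿-steps (⟿-refl G) steps =
  -- The intermediate graph is found backwards from the end: adding `Z` a second time restores `Gφ`.
  X , Y , Z , Gφ +ᴸ Z , X⊆Y , On⇒IsPivot Y swapped ,
  (λ i j → sym (xor-cancelʳ (adj Gφ i j) (diagonal Z i j)))
  where
  X Y Z : Subset n
  X = tabulate (x ∘ w)
  Y = tabulate (y ∘ w)
  Z = tabulate (z ∘ w)

  X⊆Y : X ⊆ Y
  X⊆Y {i} i∈X = lookup⇒[]= i Y (trans (lookup∘tabulate (y ∘ w) i)
    (x⇒y (w i) (trans (sym (lookup∘tabulate (x ∘ w) i)) ([]=⇒lookup i∈X))))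

  swapped : (λ i j → swapIf (lookup Y i) (graph (G +ᴸ X) i j)) On Gφ +ᴸ Z
  swapped = On-resp eq (On-+ᴸ Z carries)
    where
    eq : ∀ i j → addIf (lookup Z i) (⟦ w i ⟧ (graph G i j))
                 ≡ swapIf (lookup Y i) (graph (G +ᴸ X) i j)
    eq i j
      rewrite lookup∘tabulate (x ∘ w) i | lookup∘tabulate (y ∘ w) i | lookup∘tabulate (z ∘ w) i =
      -- The outer `addᶻ` of the normal form cancels against the added `Z`. The inner `addˣ`,
      -- applied to a pair with first entry `1ᴹ i j`, adds exactly the entry of `diagonal X`.
      trans (addIf-addIf (z (w i)) (z (w i)) p) (trans (cong (λ b → addIf b p) (xor-same (z (w i))))
      (trans (cong (proj₁ p ,_) (xor-identityʳ (proj₂ p)))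
             (cong (λ b → swapIf (y (w i)) (1ᴹ i j , adj G i j xor b)) (∧-comm (x (w i)) (1ᴹ i j)))))
      where
      p = swapIf (y (w i)) (addIf (x (w i)) (graph G i j))
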